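{- For every variable $x\in V$, every command $c\in\mathcal C$ and every relation $r\subseteq\Sigma\times\Sigma$, $$(\mathbf{var}\,x\cdot c)\Cap\mathbf{rely}\,r\;\ge\;(\mathbf{var}\,x\cdot c\Cap\mathbf{rely}(\mathsf E_xr)).$$
   Context: Commands. $(\mathcal C,\le,\bigwedge,\bigsqcup,\bot,\top)$ is a complete distributive lattice (with arbitrary meet $\bigwedge$, binary meet $\sqcap$, arbitrary join $\bigsqcup$ and binary join $\sqcup$) whose elements are called commands ($c\ge d$ is read "$c$ is refined by $d$"). It has an associative sequential composition $;$ with identity $\mathbf{nil}$, monotone in both arguments, and an associative, commutative, idempotent, monotone weak conjunction $\Cap$. Iterations: $c^0=\mathbf{nil}$, $c^{i+1}=c;c^i$; $c^\star$ (resp. $c^\omega$) is the least (resp. greatest) fixed point of $y\mapsto\mathbf{nil}\sqcup c;y$; $c^\infty=c^\omega;\bot$. One has $c^\star=\bigsqcup_{i\in\mathbb N}c^i$ and $c^\omega=c^\star\sqcup c^\infty$. States and relations. $V$ is a countable set of variables, $S$ a set, $\Sigma$ the set of partial functions $V\rightharpoonup S$. For $W\subseteq V$, $\mathrm{id}(W)$ relates $\sigma,\sigma'\in\Sigma$ iff they agree on every variable in $W$; $\mathrm{id}(x)=\mathrm{id}(\{x\})$, $\mathrm{id}(\overline x)=\mathrm{id}(V\setminus\{x\})$, and $\mathrm{id}$ is the identity relation on $\Sigma$. For $p\subseteq\Sigma$, $\mathsf E_x p$ is the image of $p$ under $\mathrm{id}(\overline x)$. For $r\subseteq\Sigma\times\Sigma$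 (with $\circ$ denoting left-to-right relational composition), $\mathsf E^{\mathsf{first}}_x r=\mathrm{id}(\overline x)\circ r$, $\mathsf E^{\mathsf{last}}_x r=r\circ\mathrm{id}(\overline x)$, $\mathsf E_x r=\mathrm{id}(\overline x)\circ r\circ\mathrm{id}(\overline x)$. $\overline r$ is the complement of $r$. Primitive commands. $\tau:\mathcal P(\Sigma)\to\mathcal C$ (tests) and $\pi,\epsilon:\mathcal P(\Sigma\times\Sigma)\to\mathcal A$ (program and environment steps) are injective homomorphisms of complete Boolean algebras onto complete Boolean sub-algebras of $\mathcal C$ (joins, and nonempty meets, computed in $\mathcal C$; complement relative to the greatest element of the sub-algebra), with $\tau(\emptyset)=\pi(\emptyset)=\epsilon(\emptyset)=\bot$ and $\tau(\Sigma)=\mathbf{nil}$. $\mathcal A\subseteq\mathcal C$ is the complete Boolean sub-algebra of atomic steps, in which $\boldsymbol\pi=\pi(\Sigma\times\Sigma)$ and $\boldsymbol\epsilon=\epsilon(\Sigma\times\Sigma)$ are complementary; $\boldsymbol\alpha=\boldsymbol\pi\sqcup\boldsymbol\epsilon$. $\mathbf{chaos}=\boldsymbol\alpha^\omega$ is the identity of $\Cap$, and $a=a\Cap(\boldsymbol\alpha;\mathbf{chaos})$ for all $a\in\mathcal A$. Localisation. For each $x\in V$ there are unary operators $\mathsf E_x,\mathsf E^{\mathsf{first}}_x,\mathsf E^{\mathsf{last}}_x$ on $\mathcal C$ (binding tighter than binary operators). Each family $F\in\{\mathsf E,\mathsf E^{\mathsf{first}},\mathsf E^{\mathsf{last}}\}$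 satisfies $c\le F_xc$; $F_x(c\sqcap F_xd)=F_xc\sqcap F_xd$; $F_xF_yc=F_yF_xc$; $F_x(\bigsqcup C)=\bigsqcup_{c\in C}F_xc$. Further axioms: $\mathsf E^{\mathsf{first}}_xc\le\mathsf E_xc$; $\mathsf E^{\mathsf{last}}_xc\le\mathsf E_xc$; $\mathsf E_x\mathsf E^{\mathsf{first}}_yc=\mathsf E^{\mathsf{first}}_y\mathsf E_xc$; $\mathsf E_x\mathsf E^{\mathsf{last}}_yc=\mathsf E^{\mathsf{last}}_y\mathsf E_xc$; $\mathsf E^{\mathsf{first}}_x\mathsf E^{\mathsf{last}}_yc=\mathsf E^{\mathsf{last}}_y\mathsf E^{\mathsf{first}}_xc$; $\mathsf E_x\tau(p)=\mathsf E^{\mathsf{first}}_x\tau(p)=\mathsf E^{\mathsf{last}}_x\tau(p)=\tau(\mathsf E_xp)$; $F_x\pi(r)=\pi(F_xr)$ and $F_x\epsilon(r)=\epsilon(F_xr)$ for each of the three $F$; $\mathsf E_x(c;\mathsf E^{\mathsf{first}}_xd)=\mathsf E_xc;\mathsf E_xd=\mathsf E_x(\mathsf E^{\mathsf{last}}_xc;d)$; if $c=c\Cap(\boldsymbol\alpha;\mathbf{chaos})$ then $\mathsf E^{\mathsf{first}}_x(c;d)=\mathsf E^{\mathsf{first}}_xc;d$ and $\mathsf E^{\mathsf{last}}_x(d;c)=d;\mathsf E^{\mathsf{last}}_xc$; $\mathsf E_x(c\Cap\mathsf E_xd)=\mathsf E_xc\Cap\mathsf E_xd$; $\mathsf E^{\mathsf{first}}_x(c\Cap\mathsf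 E^{\mathsf{first}}_xd)=\mathsf E^{\mathsf{first}}_xc\Cap\mathsf E^{\mathsf{first}}_xd$; for $a\in\mathcal A$ with $\mathsf E_xa=\mathsf E^{\mathsf{last}}_xa$, $\mathsf E_x(a^\infty)=(\mathsf E_xa)^\infty$. Derived commands. $\mathbf{guar}\,g=(\pi(g)\sqcup\boldsymbol\epsilon)^\omega$; $\mathbf{demand}\,r=(\epsilon(r)\sqcup\boldsymbol\pi)^\omega$; $\mathbf{rely}\,r=(\boldsymbol\alpha\sqcup\epsilon(\overline r);\top)^\omega=\boldsymbol\alpha^\omega;(\mathbf{nil}\sqcup\epsilon(\overline r);\top)$; $\mathbf{term}=\boldsymbol\alpha^\star;\boldsymbol\epsilon^\omega$; $\mathbf{idle}=\mathbf{term}\Cap\mathbf{guar}\,\mathrm{id}$. Known properties of the algebra: $\mathbf{rely}\,r_1\ge\mathbf{rely}\,r_2$ if $r_1\subseteq r_2$; $\mathbf{rely}\,r\Cap c\ge c$; $\mathbf{rely}\,r_1\Cap\mathbf{rely}\,r_2=\mathbf{rely}(r_1\cap r_2)$; $\mathbf{rely}\,r\Cap(c;d)\ge(\mathbf{rely}\,r\Cap c);(\mathbf{rely}\,r\Cap d)$; $\mathbf{demand}\,r\Cap\mathbf{rely}\,r=\mathbf{demand}\,r$. Local blocks. $(\mathbf{local}\,x\cdot c)=\mathsf E_x(\mathbf{demand}\,\mathrm{id}(x)\Cap c)\Cap\mathbf{guar}\,\mathrm{id}(x)$ and $(\mathbf{var}\,x\cdot c)=\mathbf{idle};(\mathbf{local}\,x\cdot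 c);\mathbf{idle}$. -}

module Defs where

open import Level using (Level; Lift; lift; lower; suc) renaming (_⊔_ to _⊔ˡ_)
open import Data.Maybe.Base using (Maybe)
open import Data.Nat.Base using (ℕ)
open import Data.Nat.GeneralisedArithmetic using (fold)
open import Data.Product.Base using (Σ-syntax; ∃-syntax; _×_; _,_)
open import Algebra.Core using (Op₁; Op₂)
open import Algebra.Structures using (IsMonoid; IsIdempotentCommutativeMonoid)
open import Function.Base using (flip)
open import Relation.Binary.Core using (Rel; _Preserves₂_⟶_⟶_)
open import Relation.Binary.Definitions using (Maximum; Minimum)
open import Relation.Binary.Lattice.Bundles using (DistributiveLattice)
open import Relation.Binary.PropositionalEquality.Core using (_≡_)
open import Relation.Unary
  using (Pred; _∈_; _⊆_; _≐_; ∁; _∩_; ⋃; ⋂; ｛_｝; _⟨∘⟩_)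
open import Relation.Unary.Polymorphic using (U; ∅)

-- Joins and meets are taken over families indexed by sets of level ι.  When
-- c ≤ ι this covers all subsets of the carrier (index a subset by itself).
record CompleteDistributiveLattice (c ℓ₁ ℓ₂ ι : Level)
       : Set (suc (c ⊔ˡ ℓ₁ ⊔ˡ ℓ₂ ⊔ˡ ι)) where
  field
    distributiveLattice : DistributiveLattice c ℓ₁ ℓ₂

  open DistributiveLattice distributiveLattice public
    renaming (_∨_ to infixr 6 _⊔_; _∧_ to infixr 7 _⊓_)

  field
    ⊤ ⊥        : Carrier
    maximum    : Maximum _≤_ ⊤
    minimum    : Minimum _≤_ ⊥
    ⋁ ⋀        : {I : Set ι} → (I → Carrier) → Carrier
    ⋁-upper    : {I : Set ι} (f : I → Carrier) → ∀ i → f i ≤ ⋁ f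
    ⋁-least    : {I : Set ι} (f : I → Carrier) → ∀ z → (∀ i → f i ≤ z) → ⋁ f ≤ z
    ⋀-lower    : {I : Set ι} (f : I → Carrier) → ∀ i → ⋀ f ≤ f i
    ⋀-greatest : {I : Set ι} (f : I → Carrier) → ∀ z → (∀ i → z ≤ f i) → z ≤ ⋀ f

  infix 4 _≥_
  _≥_ : Rel Carrier ℓ₂
  _≥_ = flip _≤_

  IsLeastFixedPoint : Op₁ Carrier → Carrier → Set (c ⊔ˡ ℓ₁ ⊔ˡ ℓ₂)
  IsLeastFixedPoint f y = (f y ≈ y) × (∀ z → f z ≈ z → y ≤ z)

  IsGreatestFixedPoint : Op₁ Carrier → Carrier → Set (c ⊔ˡ ℓ₁ ⊔ˡ ℓ₂)
  IsGreatestFixedPoint f y = (f y ≈ y) × (∀ z → f z ≈ z → z ≤ y)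

  IsComplementIn : (top a b : Carrier) → Set ℓ₁
  IsComplementIn top a b = (a ⊓ b ≈ ⊥) × (a ⊔ b ≈ top)

  -- Only nonempty meets are computed in the ambient lattice: the empty meet of
  -- the sub-algebra is top rather than ⊤.
  record IsCompleteBooleanSubalgebra {b} (B : Pred Carrier b) (top : Carrier)
         : Set (c ⊔ˡ ℓ₁ ⊔ˡ ℓ₂ ⊔ˡ suc ι ⊔ˡ b) where
    field
      respects      : ∀ {a a′} → a ≈ a′ → a ∈ B → a′ ∈ B
      top∈          : top ∈ B
      ≤-top         : ∀ {a} → a ∈ B → a ≤ top
      ⋁-closed      : {I : Set ι} (f : I → Carrier) → (∀ i → f i ∈ B) → ⋁ f ∈ B
      ⋀-closed      : {I : Set ι} (f : I → Carrier) → I → (∀ i → f i ∈ B) → ⋀ f ∈ B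
      ∁-closed      : ∀ {a} → a ∈ B → ∃[ a′ ] (a′ ∈ B × IsComplementIn top a a′)

  -- An injective homomorphism of complete Boolean algebras from the powerset
  -- of A onto its image, a sub-algebra with greatest element f U.  Injectivity
  -- and ∁-homo together force excluded middle at level ι whenever A is
  -- inhabited, so the powerset P(A) is the classical one.
  record IsBooleanEmbedding {A : Set ι} (f : Pred A ι → Carrier)
         : Set (c ⊔ˡ ℓ₁ ⊔ˡ ℓ₂ ⊔ˡ suc ι) where
    field
      cong      : ∀ {p q} → p ≐ q → f p ≈ f q
      injective : ∀ {p q} → f p ≈ f q → p ≐ q
      ⋃-homo    : {I : Set ι} (p : I → Pred A ι) → f (⋃ I p) ≈ ⋁ (λ i → f (p i))
      ⋂-homo    : {I : Set ι} (p : I → Pred A ι) → I → f (⋂ I p) ≈ ⋀ (λ i → f (p i))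
      ∁-homo    : ∀ p → IsComplementIn (f U) (f p) (f (∁ p))
      ∅-homo    : f ∅ ≈ ⊥

  record IsLocalisation {V : Set ι} (F : V → Op₁ Carrier)
         : Set (c ⊔ˡ ℓ₁ ⊔ˡ ℓ₂ ⊔ˡ suc ι) where
    field
      cong      : ∀ x {c d} → c ≈ d → F x c ≈ F x d
      extensive : ∀ x c → c ≤ F x c
      ⊓-F       : ∀ x c d → F x (c ⊓ F x d) ≈ F x c ⊓ F x d
      comm      : ∀ x y c → F x (F y c) ≈ F y (F x c)
      ⋁-homo    : ∀ x {I : Set ι} (f : I → Carrier) → F x (⋁ f) ≈ ⋁ (λ i → F x (f i))

module States {ℓ} (V S : Set ℓ) where

  -- Partial functions V ⇀ S.
  State : Set ℓ
  State = V → Maybe S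

  StateSet : Set (suc ℓ)
  StateSet = Pred State ℓ

  Relation : Set (suc ℓ)
  Relation = Pred (State × State) ℓ

  id⟨_⟩ : Pred V ℓ → Relation
  id⟨ W ⟩ (σ , σ′) = ∀ v → v ∈ W → σ v ≡ σ′ v

  -- Equality of partial functions is extensional, so the identity relation is
  -- agreement on all of V.
  Id : Relation
  Id = id⟨ U ⟩

  id[_] : V → Relation
  id[ x ] = id⟨ ｛ x ｝ ⟩

  idExcept[_] : V → Relation
  idExcept[ x ] = id⟨ ∁ ｛ x ｝ ⟩

  Eˢ : V → StateSet → StateSet
  Eˢ x p σ′ = ∃[ σ ] (σ ∈ p × (σ , σ′) ∈ idExcept[ x ])

  E-firstʳ E-lastʳ Eʳ : V → Relation → Relation
  E-firstʳ x r = idExcept[ x ] ⟨∘⟩ r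
  E-lastʳ  x r = r ⟨∘⟩ idExcept[ x ]
  Eʳ       x r = idExcept[ x ] ⟨∘⟩ (r ⟨∘⟩ idExcept[ x ])

record CommandAlgebra {ℓ} (V S : Set ℓ) (c ℓ₁ ℓ₂ a : Level)
       : Set (suc (ℓ ⊔ˡ c ⊔ˡ ℓ₁ ⊔ˡ ℓ₂ ⊔ˡ a)) where
  open States V S public

  field
    completeLattice : CompleteDistributiveLattice c ℓ₁ ℓ₂ ℓ

  open CompleteDistributiveLattice completeLattice public

  infixr 8 _⨾_
  infixr 5 _⋒_
  infix 9 _^_ _⋆ _ω _∞

  field
    nil        : Carrier
    _⨾_        : Op₂ Carrier
    ⨾-isMonoid : IsMonoid _≈_ _⨾_ nil
    ⨾-mono     : _⨾_ Preserves₂ _≤_ ⟶ _≤_ ⟶ _≤_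

    _⋆ _ω : Op₁ Carrier
    ⋆-lfp : ∀ c → IsLeastFixedPoint    (λ y → nil ⊔ c ⨾ y) (c ⋆)
    ω-gfp : ∀ c → IsGreatestFixedPoint (λ y → nil ⊔ c ⨾ y) (c ω)

  _^_ : Carrier → ℕ → Carrier
  c ^ i = fold nil (c ⨾_) i

  _∞ : Op₁ Carrier
  c ∞ = c ω ⨾ ⊥

  -- These two laws hold in the full algebra through distributivity properties of
  -- _⨾_ that are not otherwise assumed here.
  field
    ⋆-⋁-powers : ∀ c → c ⋆ ≈ ⋁ {Lift ℓ ℕ} (λ i → c ^ lower i)
    ω-split    : ∀ c → c ω ≈ c ⋆ ⊔ c ∞

    τ   : StateSet → Carrier
    π ε : Relation → Carrier
    τ-embedding : IsBooleanEmbedding τ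
    π-embedding : IsBooleanEmbedding π
    ε-embedding : IsBooleanEmbedding ε
    τ-nil       : τ U ≈ nil

  𝛑 : Carrier
  𝛑 = π U

  𝛆 : Carrier
  𝛆 = ε U

  𝛂 : Carrier
  𝛂 = 𝛑 ⊔ 𝛆

  chaos : Carrier
  chaos = 𝛂 ω

  field
    𝒜            : Pred Carrier a
    𝒜-subalgebra : IsCompleteBooleanSubalgebra 𝒜 𝛂
    π∈𝒜          : ∀ r → π r ∈ 𝒜
    ε∈𝒜          : ∀ r → ε r ∈ 𝒜
    𝛑-𝛆-compl    : IsComplementIn 𝛂 𝛑 𝛆

    _⋒_        : Op₂ Carrier
    ⋒-isIdempotentCommutativeMonoid : IsIdempotentCommutativeMonoid _≈_ _⋒_ chaos
    ⋒-mono     : _⋒_ Preserves₂ _≤_ ⟶ _≤_ ⟶ _≤_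
    𝒜-⋒        : ∀ {a} → a ∈ 𝒜 → a ≈ a ⋒ (𝛂 ⨾ chaos)

  guar : Relation → Carrier
  guar g = (π g ⊔ 𝛆) ω

  demand : Relation → Carrier
  demand r = (ε r ⊔ 𝛑) ω

  rely : Relation → Carrier
  rely r = (𝛂 ⊔ ε (∁ r) ⨾ ⊤) ω

  term : Carrier
  term = 𝛂 ⋆ ⨾ 𝛆 ω

  idle : Carrier
  idle = term ⋒ guar Id

  -- Known properties of relies; deriving all of them needs further laws for the
  -- interaction of _⋒_ with _⨾_, so they are taken as given.
  field
    rely-chaos  : ∀ r → rely r ≈ 𝛂 ω ⨾ (nil ⊔ ε (∁ r) ⨾ ⊤)
    rely-anti   : ∀ {r₁ r₂} → r₁ ⊆ r₂ → rely r₁ ≥ rely r₂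
    rely-remove : ∀ r c → rely r ⋒ c ≥ c
    rely-∩      : ∀ r₁ r₂ → rely r₁ ⋒ rely r₂ ≈ rely (r₁ ∩ r₂)
    rely-⨾      : ∀ r c d → rely r ⋒ (c ⨾ d) ≥ (rely r ⋒ c) ⨾ (rely r ⋒ d)
    demand-rely : ∀ r → demand r ⋒ rely r ≈ demand r

record LocalisationAlgebra {ℓ} (V S : Set ℓ) (c ℓ₁ ℓ₂ a : Level)
       : Set (suc (ℓ ⊔ˡ c ⊔ˡ ℓ₁ ⊔ˡ ℓ₂ ⊔ˡ a)) where
  field
    commandAlgebra : CommandAlgebra V S c ℓ₁ ℓ₂ a

  open CommandAlgebra commandAlgebra public

  field
    E E-first E-last     : V → Op₁ Carrier
    E-isLocalisation       : IsLocalisation E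
    E-first-isLocalisation : IsLocalisation E-first
    E-last-isLocalisation  : IsLocalisation E-last

    E-first≤E      : ∀ x c → E-first x c ≤ E x c
    E-last≤E       : ∀ x c → E-last x c ≤ E x c
    E-E-first      : ∀ x y c → E x (E-first y c) ≈ E-first y (E x c)
    E-E-last       : ∀ x y c → E x (E-last y c) ≈ E-last y (E x c)
    E-first-E-last : ∀ x y c → E-first x (E-last y c) ≈ E-last y (E-first x c)

    E-τ       : ∀ x p → E x (τ p) ≈ τ (Eˢ x p)
    E-first-τ : ∀ x p → E-first x (τ p) ≈ τ (Eˢ x p)
    E-last-τ  : ∀ x p → E-last x (τ p) ≈ τ (Eˢ x p)

    E-π       : ∀ x r → E x (π r) ≈ π (Eʳ x r)
    E-first-π : ∀ x r → E-first x (π r) ≈ π (E-firstʳ x r)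
    E-last-π  : ∀ x r → E-last x (π r) ≈ π (E-lastʳ x r)
    E-ε       : ∀ x r → E x (ε r) ≈ ε (Eʳ x r)
    E-first-ε : ∀ x r → E-first x (ε r) ≈ ε (E-firstʳ x r)
    E-last-ε  : ∀ x r → E-last x (ε r) ≈ ε (E-lastʳ x r)

    E-⨾-first : ∀ x c d → E x (c ⨾ E-first x d) ≈ E x c ⨾ E x d
    E-⨾-last  : ∀ x c d → E x (E-last x c ⨾ d) ≈ E x c ⨾ E x d
    E-first-⨾ : ∀ x c d → c ≈ c ⋒ (𝛂 ⨾ chaos) → E-first x (c ⨾ d) ≈ E-first x c ⨾ d
    E-last-⨾  : ∀ x c d → c ≈ c ⋒ (𝛂 ⨾ chaos) → E-last x (d ⨾ c) ≈ d ⨾ E-last x c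

    E-⋒       : ∀ x c d → E x (c ⋒ E x d) ≈ E x c ⋒ E x d
    E-first-⋒ : ∀ x c d → E-first x (c ⋒ E-first x d) ≈ E-first x c ⋒ E-first x d

    E-∞ : ∀ x {a} → a ∈ 𝒜 → E x a ≈ E-last x a → E x (a ∞) ≈ (E x a) ∞

  local var : V → Carrier → Carrier
  local x c = E x (demand id[ x ] ⋒ c) ⋒ guar id[ x ]
  var   x c = idle ⨾ local x c ⨾ idle

{-# OPTIONS --safe #-}

-- A rely condition Eʳ x r cannot observe x, so the command rely (Eʳ x r) is
-- invariant under E x.  It can therefore be taken out of the localisation in a
-- local block by E-⋒, and it refines rely r because r ⊆ Eʳ x r.
-- The idle commands on either side are dealt with by rely-⨾ and rely-remove.

module Submission where

open import Defs
open import Level using (Level; Lift; lift)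
open import Data.Bool.Base using (Bool; true; false; if_then_else_)
open import Data.Nat.Base using (ℕ; zero; suc)
open import Data.Product.Base using (_,_; proj₁; proj₂)
open import Algebra.Structures using (IsMonoid; IsIdempotentCommutativeMonoid)
open import Function.Bundles using (_↣_)
import Relation.Binary.Lattice.Properties.JoinSemilattice as JoinSemilatticeProperties
import Relation.Binary.PropositionalEquality.Core as ≡
import Relation.Binary.Reasoning.PartialOrder as PosetReasoning
open import Relation.Unary using (_∈_; _⊆_; _≐_; ∁)
open import Relation.Unary.Polymorphic using (U)

module StateProperties {ℓ} (V S : Set ℓ) where
  open States V S

  idExcept-refl : ∀ x {σ} → (σ , σ) ∈ idExcept[ x ]
  idExcept-refl x _ _ = ≡.refl

  idExcept-sym : ∀ x {σ σ′} → (σ , σ′) ∈ idExcept[ x ] → (σ′ , σ) ∈ idExcept[ x ]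
  idExcept-sym x p v v≢x = ≡.sym (p v v≢x)

  idExcept-trans : ∀ x {σ σ′ σ″} → (σ , σ′) ∈ idExcept[ x ] →
                   (σ′ , σ″) ∈ idExcept[ x ] → (σ , σ″) ∈ idExcept[ x ]
  idExcept-trans x p q v v≢x = ≡.trans (p v v≢x) (q v v≢x)

  Eˢ-extensive : ∀ x p → p ⊆ Eˢ x p
  Eˢ-extensive x p {σ} σ∈p = σ , σ∈p , idExcept-refl x

  Eˢ-U : ∀ x → Eˢ x U ≐ U
  Eˢ-U x = (λ _ → _) , Eˢ-extensive x U

  Eʳ-extensive : ∀ x r → r ⊆ Eʳ x r
  Eʳ-extensive x r {σ , σ′} σσ′∈r =
    σ , idExcept-refl x , σ′ , σσ′∈r , idExcept-refl x

  Eʳ-U : ∀ x → Eʳ x U ≐ U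
  Eʳ-U x = (λ _ → _) , Eʳ-extensive x U

  -- Agreement off `x` is an equivalence, so `Eʳ x r` is saturated under it on both sides, and the
  -- complement of a saturated relation is saturated: a pair related to a member of `Eʳ x r` is
  -- itself a member. This is the complement occurring inside `rely (Eʳ x r)`.
  Eʳ-∁-Eʳ : ∀ x r → Eʳ x (∁ (Eʳ x r)) ≐ ∁ (Eʳ x r)
  Eʳ-∁-Eʳ x r =
    (λ { (_ , σρ , _ , ρρ′∉Er , ρ′σ′) (_ , σμ , _ , μμ′∈r , μ′σ′) →
         ρρ′∉Er ( _ , idExcept-trans x (idExcept-sym x σρ) σμ
                , _ , μμ′∈r
                , idExcept-trans x μ′σ′ (idExcept-sym x ρ′σ′)) })
    , Eʳ-extensive x (∁ (Eʳ x r))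

module RelyLocalisation {ℓ c ℓ₁ ℓ₂ a : Level} (V S : Set ℓ)
         (𝔸 : LocalisationAlgebra V S c ℓ₁ ℓ₂ a) where
  open LocalisationAlgebra 𝔸
  open StateProperties V S
  open IsMonoid ⨾-isMonoid using () renaming (∙-cong to ⨾-cong)
  open IsIdempotentCommutativeMonoid ⋒-isIdempotentCommutativeMonoid using ()
    renaming (∙-cong to ⋒-cong; assoc to ⋒-assoc; comm to ⋒-comm)
  open JoinSemilatticeProperties joinSemilattice using (∨-cong)
  open IsBooleanEmbedding
  private
    module E = IsLocalisation E-isLocalisation
    module E-first = IsLocalisation E-first-isLocalisation
    module E-last = IsLocalisation E-last-isLocalisation
  open PosetReasoning poset

  Invariant : V → Carrier → Set ℓ₁
  Invariant x d = E x d ≈ d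

  invariant : ∀ {x d} → E x d ≤ d → Invariant x d
  invariant Ed≤d = antisym Ed≤d (E.extensive _ _)

  invariant-resp-≈ : ∀ {x d e} → d ≈ e → Invariant x d → Invariant x e
  invariant-resp-≈ d≈e Ed≈d =
    Eq.trans (E.cong _ (Eq.sym d≈e)) (Eq.trans Ed≈d d≈e)

  -- `E-first x d` is squeezed between `d` and `E x d`.
  E-first-invariant : ∀ {x d} → Invariant x d → E-first x d ≈ d
  E-first-invariant Ed≈d =
    antisym (≤-respʳ-≈ Ed≈d (E-first≤E _ _)) (E-first.extensive _ _)

  E-last-invariant : ∀ {x d} → Invariant x d → E-last x d ≈ d
  E-last-invariant Ed≈d =
    antisym (≤-respʳ-≈ Ed≈d (E-last≤E _ _)) (E-last.extensive _ _)

  -- The axiom splits `E x` over a composition only if the second factor is an `E-first x` image,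
  -- which an invariant command is.
  ⨾-invariant : ∀ {x d e} → Invariant x d → Invariant x e → Invariant x (d ⨾ e)
  ⨾-invariant {x} {d} {e} Ed≈d Ee≈e = begin-equality
    E x (d ⨾ e)            ≈⟨ E.cong x (⨾-cong Eq.refl (E-first-invariant Ee≈e)) ⟨
    E x (d ⨾ E-first x e)  ≈⟨ E-⨾-first x d e ⟩
    E x d ⨾ E x e          ≈⟨ ⨾-cong Ed≈d Ee≈e ⟩
    d ⨾ e                  ∎

  ⋁-invariant : ∀ {x} {I : Set ℓ} (f : I → Carrier) →
                (∀ i → Invariant x (f i)) → Invariant x (⋁ f)
  ⋁-invariant {x} f Ef≈f = invariant (begin
    E x (⋁ f)            ≈⟨ E.⋁-homo x f ⟩
    ⋁ (λ i → E x (f i))  ≤⟨ ⋁-least _ _ (λ i → ≤-respˡ-≈ (Eq.sym (Ef≈f i)) (⋁-upper f i)) ⟩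
    ⋁ f                  ∎)

  -- Localisations are assumed to preserve indexed joins; this transfers the law to binary ones.
  ⊔-as-⋁ : ∀ d e → ⋁ {Lift ℓ Bool} (λ (lift b) → if b then d else e) ≈ d ⊔ e
  ⊔-as-⋁ d e = antisym
    (⋁-least _ _ λ { (lift true) → x≤x∨y d e ; (lift false) → y≤x∨y d e })
    (∨-least (⋁-upper _ (lift true)) (⋁-upper _ (lift false)))

  ⊔-invariant : ∀ {x d e} → Invariant x d → Invariant x e → Invariant x (d ⊔ e)
  ⊔-invariant Ed≈d Ee≈e = invariant-resp-≈ (⊔-as-⋁ _ _)
    (⋁-invariant _ λ { (lift true) → Ed≈d ; (lift false) → Ee≈e })

  ⊤-invariant : ∀ {x} → Invariant x ⊤
  ⊤-invariant = invariant (maximum _)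

  nil-invariant : ∀ {x} → Invariant x nil
  nil-invariant {x} = invariant-resp-≈ τ-nil
    (Eq.trans (E-τ x U) (cong τ-embedding (Eˢ-U x)))

  π-invariant : ∀ {x r} → Eʳ x r ≐ r → Invariant x (π r)
  π-invariant Er≐r = Eq.trans (E-π _ _) (cong π-embedding Er≐r)

  ε-invariant : ∀ {x r} → Eʳ x r ≐ r → Invariant x (ε r)
  ε-invariant Er≐r = Eq.trans (E-ε _ _) (cong ε-embedding Er≐r)

  𝛂-invariant : ∀ {x} → Invariant x 𝛂
  𝛂-invariant = ⊔-invariant (π-invariant (Eʳ-U _)) (ε-invariant (Eʳ-U _))

  ^-invariant : ∀ {x d} → Invariant x d → ∀ i → Invariant x (d ^ i)
  ^-invariant Ed≈d zero    = nil-invariant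
  ^-invariant Ed≈d (suc i) = ⨾-invariant Ed≈d (^-invariant Ed≈d i)

  ⋆-invariant : ∀ {x d} → Invariant x d → Invariant x (d ⋆)
  ⋆-invariant {d = d} Ed≈d = invariant-resp-≈ (Eq.sym (⋆-⋁-powers d))
    (⋁-invariant _ λ (lift i) → ^-invariant Ed≈d i)

  -- Congruence of `_ω` is not an axiom but follows from the greatest fixed point property: `d ω`
  -- also solves the equation that defines `e ω`.
  ω-subst-≤ : ∀ {d e} → d ≈ e → d ω ≤ e ω
  ω-subst-≤ {d} {e} d≈e = proj₂ (ω-gfp e) (d ω) (begin-equality
    nil ⊔ e ⨾ d ω  ≈⟨ ∨-cong Eq.refl (⨾-cong (Eq.sym d≈e) Eq.refl) ⟩
    nil ⊔ d ⨾ d ω  ≈⟨ proj₁ (ω-gfp d) ⟩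
    d ω            ∎)

  ∞-invariant : ∀ {x d} → d ∈ 𝒜 → Invariant x d → Invariant x (d ∞)
  ∞-invariant {x} {d} d∈𝒜 Ed≈d = invariant (begin
    E x (d ∞)    ≈⟨ E-∞ x d∈𝒜 (Eq.trans Ed≈d (Eq.sym (E-last-invariant Ed≈d))) ⟩
    E x d ω ⨾ ⊥  ≤⟨ ⨾-mono (ω-subst-≤ Ed≈d) (minimum ⊥) ⟩
    d ω ⨾ ⊥      ∎)

  -- The finite part is a join of powers; the infinite part rests on `E-∞`, hence the restriction to
  -- atomic `d`.
  ω-invariant : ∀ {x d} → d ∈ 𝒜 → Invariant x d → Invariant x (d ω)
  ω-invariant {d = d} d∈𝒜 Ed≈d = invariant-resp-≈ (Eq.sym (ω-split d))
    (⊔-invariant (⋆-invariant Ed≈d) (∞-invariant d∈𝒜 Ed≈d))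

  rely-invariant : ∀ {x r} → Eʳ x (∁ r) ≐ ∁ r → Invariant x (rely r)
  -- The defining iteration has a body not known to be atomic. In the form given by `rely-chaos`
  -- only `𝛂` is iterated, and `𝛂` is the top of `𝒜`.
  rely-invariant {r = r} E∁r≐∁r = invariant-resp-≈ (Eq.sym (rely-chaos r))
    (⨾-invariant
      (ω-invariant (IsCompleteBooleanSubalgebra.top∈ 𝒜-subalgebra) 𝛂-invariant)
      (⊔-invariant nil-invariant (⨾-invariant (ε-invariant E∁r≐∁r) ⊤-invariant)))

  E-⋒-invariant : ∀ {x} d {e} → Invariant x e → E x (d ⋒ e) ≈ E x d ⋒ e
  E-⋒-invariant {x} d {e} Ee≈e = begin-equality
    E x (d ⋒ e)      ≈⟨ E.cong x (⋒-cong Eq.refl Ee≈e) ⟨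
    E x (d ⋒ E x e)  ≈⟨ E-⋒ x d e ⟩
    E x d ⋒ E x e    ≈⟨ ⋒-cong Eq.refl Ee≈e ⟩
    E x d ⋒ e        ∎

  local-rely : ∀ x d r → rely r ⋒ local x d ≥ local x (d ⋒ rely (Eʳ x r))
  local-rely x d r = begin
    E x (D ⋒ (d ⋒ R)) ⋒ G  ≈⟨ ⋒-cong (E.cong x (Eq.sym (⋒-assoc D d R))) Eq.refl ⟩
    E x ((D ⋒ d) ⋒ R) ⋒ G  ≈⟨ ⋒-cong (E-⋒-invariant (D ⋒ d) (rely-invariant (Eʳ-∁-Eʳ x r))) Eq.refl ⟩
    (E x (D ⋒ d) ⋒ R) ⋒ G  ≈⟨ ⋒-cong (⋒-comm _ R) Eq.refl ⟩
    (R ⋒ E x (D ⋒ d)) ⋒ G  ≈⟨ ⋒-assoc R _ G ⟩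
    -- The only step that is not an equality: `rely` is monotone from inclusion of relations to the
    -- reversed order `_≥_`.
    R ⋒ local x d          ≤⟨ ⋒-mono (rely-anti (Eʳ-extensive x r)) refl ⟩
    rely r ⋒ local x d     ∎
    where
    D = demand id[ x ]
    G = guar id[ x ]
    R = rely (Eʳ x r)

  var-rely : ∀ x d r → var x d ⋒ rely r ≥ var x (d ⋒ rely (Eʳ x r))
  var-rely x d r = begin
    idle ⨾ L′ ⨾ idle                           ≤⟨ ⨾-mono (rely-remove r idle)
                                                   (⨾-mono (local-rely x d r) (rely-remove r idle)) ⟩
    -- The three copies of `rely r` merge into one, starting from the right as `_⨾_` associates that
    -- way.
    (R ⋒ idle) ⨾ (R ⋒ local x d) ⨾ (R ⋒ idle)  ≤⟨ ⨾-mono refl (rely-⨾ r (local x d) idle) ⟩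
    (R ⋒ idle) ⨾ (R ⋒ (local x d ⨾ idle))      ≤⟨ rely-⨾ r idle (local x d ⨾ idle) ⟩
    R ⋒ var x d                                ≈⟨ ⋒-comm R (var x d) ⟩
    var x d ⋒ R                                ∎
    where
    R  = rely r
    L′ = local x (d ⋒ rely (Eʳ x r))

mainTheorem6 : ∀ {ℓ c ℓ₁ ℓ₂ a : Level} (V S : Set ℓ) → V ↣ ℕ →
    (𝔸 : LocalisationAlgebra V S c ℓ₁ ℓ₂ a) → let open LocalisationAlgebra 𝔸 in
    (x : V) (c : Carrier) (r : Relation) →
    var x c ⋒ rely r ≥ var x (c ⋒ rely (Eʳ x r))
mainTheorem6 V S _ 𝔸 = RelyLocalisation.var-rely V S 𝔸
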